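{- Let $p,q,r\in\mathbb{R}$. The polynomial $x^3+px^2+qx+r$ is a Ramanujan cubic polynomial if and only if there exist $h,s\in\mathbb{R}$ with $s\neq 0$ such that $$r=s^3,\qquad q=-(h+3)s^2,\qquad p=hs.$$
   Context: A Ramanujan cubic polynomial (RCP) is a cubic polynomial $x^3+px^2+qx+r$ with $p,q,r\in\mathbb{R}$, $r\neq 0$, all of whose zeros are real and whose coefficients satisfy $p\,r^{1/3}+3\,r^{2/3}+q=0$. Here $r^{1/3}$ denotes the real cube root and $r^{2/3}=(r^{1/3})^2$. -}

module Defs where

open import Algebra.Bundles.Raw using (RawRing)
import Algebra.Definitions.RawSemiring as RawSemiringDefs
open import Data.Integer.Base as ℤ using (+_; -[1+_])
import Data.Integer.Properties as ℤ
open import Data.Nat.Base as ℕ using (ℕ; zero; suc)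
import Data.Nat.Properties as ℕ
open import Data.Product.Base using (∃; _×_; _,_; proj₁; proj₂)
open import Data.Rational.Base as ℚ using (ℚ; mkℚ; 0ℚ; 1ℚ; ½; ∣_∣)
import Data.Rational.Properties as ℚ
import Data.Rational.Unnormalised.Base as ℚᵘ
import Data.Rational.Unnormalised.Properties as ℚᵘ
open import Data.Rational.Solver using (module +-*-Solver)
open import Data.Sum.Base using (inj₁; inj₂)
open import Level using (0ℓ)
open import Relation.Binary.PropositionalEquality
  using (_≡_; refl; sym; trans; cong; subst; subst₂)
open import Relation.Nullary using (yes; no; contradiction)

open +-*-Solver using (solve; _:=_; _:+_; _:*_; _:-_; :-_; con)

private
  variable
    a b c d δ ε : ℚ

Cauchy : (ℕ → ℚ) → Set
Cauchy f = ∀ {ε} → 0ℚ ℚ.< ε →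
  ∃ λ N → ∀ {m n} → N ℕ.≤ m → N ℕ.≤ n → ∣ f m ℚ.- f n ∣ ℚ.< ε

-- Rational estimates showing that the operations on reals, including the cube
-- root, preserve the Cauchy condition.
module ℚ-Lemmas where

  3ℚ 4ℚ ¼ : ℚ
  3ℚ = + 3 ℚ./ 1
  4ℚ = + 4 ℚ./ 1
  ¼  = + 1 ℚ./ 4

  from-diff : 0ℚ ℚ.≤ b ℚ.- a → a ℚ.≤ b
  from-diff {b} {a} h =
    subst₂ ℚ._≤_ (ℚ.+-identityˡ a)
      (solve 2 (λ b a → (b :- a) :+ a := b) refl b a) (ℚ.+-monoˡ-≤ a h)

  to-diff : a ℚ.≤ b → 0ℚ ℚ.≤ b ℚ.- a
  to-diff {a} {b} h = subst (ℚ._≤ b ℚ.- a) (ℚ.+-inverseʳ a) (ℚ.+-monoˡ-≤ (ℚ.- a) h)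

  0≤* : 0ℚ ℚ.≤ a → 0ℚ ℚ.≤ b → 0ℚ ℚ.≤ a ℚ.* b
  0≤* {a} {b} 0≤a 0≤b =
    subst (ℚ._≤ a ℚ.* b) (ℚ.*-zeroʳ a) (ℚ.*-monoˡ-≤-nonNeg a {{ℚ.nonNegative 0≤a}} 0≤b)

  0≤+ : 0ℚ ℚ.≤ a → 0ℚ ℚ.≤ b → 0ℚ ℚ.≤ a ℚ.+ b
  0≤+ = ℚ.+-mono-≤

  0<* : 0ℚ ℚ.< a → 0ℚ ℚ.< b → 0ℚ ℚ.< a ℚ.* b
  0<* {a} {b} 0<a 0<b =
    subst (ℚ._< a ℚ.* b) (ℚ.*-zeroʳ a) (ℚ.*-monoʳ-<-pos a {{ℚ.positive 0<a}} 0<b)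

  0≤sq : ∀ a → 0ℚ ℚ.≤ a ℚ.* a
  0≤sq a with ℚ.≤-total 0ℚ a
  ... | inj₁ 0≤a = 0≤* 0≤a 0≤a
  ... | inj₂ a≤0 = subst (0ℚ ℚ.≤_) (solve 1 (λ a → (:- a) :* (:- a) := a :* a) refl a)
                     (0≤* 0≤-a 0≤-a)
    where 0≤-a = ℚ.neg-antimono-≤ a≤0

  *-mono-≤ : 0ℚ ℚ.≤ a → a ℚ.≤ c → 0ℚ ℚ.≤ b → b ℚ.≤ d → a ℚ.* b ℚ.≤ c ℚ.* d
  *-mono-≤ {a} {c} {b} 0≤a a≤c 0≤b b≤d =
    ℚ.≤-trans (ℚ.*-monoʳ-≤-nonNeg b {{ℚ.nonNegative 0≤b}} a≤c)
              (ℚ.*-monoˡ-≤-nonNeg c {{ℚ.nonNegative (ℚ.≤-trans 0≤a a≤c)}} b≤d)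

  0<½* : 0ℚ ℚ.< ε → 0ℚ ℚ.< ½ ℚ.* ε
  0<½* = 0<* (ℚ.positive⁻¹ ½)

  ½+½ : ∀ ε → ½ ℚ.* ε ℚ.+ ½ ℚ.* ε ≡ ε
  ½+½ = solve 1 (λ ε → con ½ :* ε :+ con ½ :* ε := ε) refl

  split : 0ℚ ℚ.< ε → 0ℚ ℚ.< c → ∃ λ δ → 0ℚ ℚ.< δ × δ ℚ.* c ≡ ε
  split {ε} {c} 0<ε 0<c = ε ℚ.* c⁻¹ , 0<* 0<ε (ℚ.positive⁻¹ c⁻¹ {{ℚ.1/pos⇒pos c}}) ,
    trans (ℚ.*-assoc ε c⁻¹ c) (trans (cong (ε ℚ.*_) (ℚ.*-inverseˡ c)) (ℚ.*-identityʳ ε))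
    where
    instance
      c-pos = ℚ.positive 0<c
      c-nz  = ℚ.pos⇒nonZero c
    c⁻¹ = ℚ.1/ c

  ∣-∣-comm : ∀ a b → ∣ a ℚ.- b ∣ ≡ ∣ b ℚ.- a ∣
  ∣-∣-comm a b = trans (sym (ℚ.∣-p∣≡∣p∣ (a ℚ.- b)))
    (cong ∣_∣ (solve 2 (λ a b → :- (a :- b) := b :- a) refl a b))

  a≤∣a∣ : ∀ a → a ℚ.≤ ∣ a ∣
  a≤∣a∣ a with ℚ.≤-total 0ℚ a
  ... | inj₁ 0≤a = ℚ.≤-reflexive (sym (ℚ.0≤p⇒∣p∣≡p 0≤a))
  ... | inj₂ a≤0 = ℚ.≤-trans a≤0 (ℚ.0≤∣p∣ a)

  ∣∣≤ : a ℚ.≤ c → ℚ.- a ℚ.≤ c → ∣ a ∣ ℚ.≤ c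
  ∣∣≤ {a} {c} h k with ℚ.∣p∣≡p∨∣p∣≡-p a
  ... | inj₁ e = subst (ℚ._≤ c) (sym e) h
  ... | inj₂ e = subst (ℚ._≤ c) (sym e) k

  ∣-∣< : ∀ a b → a ℚ.- b ℚ.< ε → b ℚ.- a ℚ.< ε → ∣ a ℚ.- b ∣ ℚ.< ε
  ∣-∣< {ε} a b h k with ℚ.∣p∣≡p∨∣p∣≡-p (a ℚ.- b)
  ... | inj₁ e = subst (ℚ._< ε) (sym e) h
  ... | inj₂ e = subst (ℚ._< ε)
                   (sym (trans e (solve 2 (λ a b → :- (a :- b) := b :- a) refl a b))) k

  ∣*∣< : ∀ a b → 0ℚ ℚ.< δ → ∣ a ∣ ℚ.< δ → ∣ b ∣ ℚ.< c → ∣ a ℚ.* b ∣ ℚ.< δ ℚ.* c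
  ∣*∣< {δ} {c} a b 0<δ a<δ b<c = ℚ.≤-<-trans
    (subst (ℚ._≤ δ ℚ.* ∣ b ∣) (sym (ℚ.∣p*q∣≡∣p∣*∣q∣ a b))
      (ℚ.*-monoʳ-≤-nonNeg ∣ b ∣ {{ℚ.∣-∣-nonNeg b}} (ℚ.<⇒≤ a<δ)))
    (ℚ.*-monoʳ-<-pos δ {{ℚ.positive 0<δ}} b<c)

  triangle : ∀ a b c → ∣ a ℚ.- c ∣ ℚ.≤ ∣ a ℚ.- b ∣ ℚ.+ ∣ b ℚ.- c ∣
  triangle a b c = subst (λ t → ∣ t ∣ ℚ.≤ ∣ a ℚ.- b ∣ ℚ.+ ∣ b ℚ.- c ∣)
    (solve 3 (λ a b c → (a :- b) :+ (b :- c) := a :- c) refl a b c)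
    (ℚ.∣p+q∣≤∣p∣+∣q∣ (a ℚ.- b) (b ℚ.- c))

  ¼+½+¼ : ∀ ε → ½ ℚ.* (½ ℚ.* ε) ℚ.+ (½ ℚ.* ε ℚ.+ ½ ℚ.* (½ ℚ.* ε)) ≡ ε
  ¼+½+¼ = solve 1
    (λ ε → con ½ :* (con ½ :* ε) :+ (con ½ :* ε :+ con ½ :* (con ½ :* ε)) := ε) refl

  ∣-∣-neg : ∀ a b → ∣ a ℚ.- b ∣ ≡ ∣ ℚ.- b ℚ.- (ℚ.- a) ∣
  ∣-∣-neg a b = cong ∣_∣ (solve 2 (λ a b → a :- b := (:- b) :- (:- a)) refl a b)

  ∣-∣-bound : ∀ a b → ∣ a ∣ ℚ.≤ ∣ a ℚ.- b ∣ ℚ.+ ∣ b ∣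
  ∣-∣-bound a b = subst (λ t → ∣ t ∣ ℚ.≤ ∣ a ℚ.- b ∣ ℚ.+ ∣ b ∣)
    (solve 2 (λ a b → (a :- b) :+ b := a) refl a b) (ℚ.∣p+q∣≤∣p∣+∣q∣ (a ℚ.- b) b)

  ∣-∣-+ : ∀ a b c d → ∣ (a ℚ.+ c) ℚ.- (b ℚ.+ d) ∣ ℚ.≤ ∣ a ℚ.- b ∣ ℚ.+ ∣ c ℚ.- d ∣
  ∣-∣-+ a b c d = subst (λ t → ∣ t ∣ ℚ.≤ ∣ a ℚ.- b ∣ ℚ.+ ∣ c ℚ.- d ∣)
    (solve 4 (λ a b c d → (a :- b) :+ (c :- d) := (a :+ c) :- (b :+ d)) refl a b c d)
    (ℚ.∣p+q∣≤∣p∣+∣q∣ (a ℚ.- b) (c ℚ.- d))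

  ∣-∣-* : ∀ a b c d →
    ∣ a ℚ.* c ℚ.- b ℚ.* d ∣ ℚ.≤ ∣ (a ℚ.- b) ℚ.* c ∣ ℚ.+ ∣ (c ℚ.- d) ℚ.* b ∣
  ∣-∣-* a b c d = subst (λ t → ∣ t ∣ ℚ.≤ ∣ (a ℚ.- b) ℚ.* c ∣ ℚ.+ ∣ (c ℚ.- d) ℚ.* b ∣)
    (solve 4 (λ a b c d → (a :- b) :* c :+ (c :- d) :* b := a :* c :- b :* d) refl a b c d)
    (ℚ.∣p+q∣≤∣p∣+∣q∣ ((a ℚ.- b) ℚ.* c) ((c ℚ.- d) ℚ.* b))

  infix 9 ½^_

  ½^_ : ℕ → ℚ
  ½^ zero  = 1ℚ
  ½^ suc n = ½ ℚ.* ½^ n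

  0<½^ : ∀ n → 0ℚ ℚ.< ½^ n
  0<½^ zero    = ℚ.positive⁻¹ 1ℚ
  0<½^ (suc n) = 0<½* (0<½^ n)

  ½^-≤1 : ∀ n → ½^ n ℚ.≤ 1ℚ
  ½^-≤1 zero    = ℚ.≤-refl
  ½^-≤1 (suc n) =
    ℚ.≤-trans (ℚ.*-monoˡ-≤-nonNeg ½ (½^-≤1 n)) (ℚ.<⇒≤ (ℚ.*<* (ℤ.+<+ (ℕ.s≤s (ℕ.s≤s ℕ.z≤n)))))

  ½^-antimono : ∀ {m n} → m ℕ.≤ n → ½^ n ℚ.≤ ½^ m
  ½^-antimono {n = n} ℕ.z≤n = ½^-≤1 n
  ½^-antimono (ℕ.s≤s m≤n)   = ℚ.*-monoˡ-≤-nonNeg ½ (½^-antimono m≤n)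

  fromℕ : ℕ → ℚ
  fromℕ zero    = 0ℚ
  fromℕ (suc n) = 1ℚ ℚ.+ fromℕ n

  n*½^n≤1 : ∀ n → fromℕ n ℚ.* ½^ n ℚ.≤ 1ℚ
  n*½^n≤1 zero    = ℚ.<⇒≤ (ℚ.positive⁻¹ 1ℚ)
  n*½^n≤1 (suc n) = subst (ℚ._≤ 1ℚ)
    (solve 2 (λ n h → con ½ :* (h :+ n :* h) := (con 1ℚ :+ n) :* (con ½ :* h)) refl (fromℕ n) (½^ n))
    (ℚ.*-monoˡ-≤-nonNeg ½ (ℚ.+-mono-≤ (½^-≤1 n) (n*½^n≤1 n)))

  toℚᵘ-fromℕ : ∀ n → ℚ.toℚᵘ (fromℕ n) ℚᵘ.≃ ℚᵘ.mkℚᵘ (+ n) 0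
  toℚᵘ-fromℕ zero    = ℚᵘ.≃-refl
  toℚᵘ-fromℕ (suc n) = ℚᵘ.≃-trans (ℚ.toℚᵘ-homo-+ 1ℚ (fromℕ n))
    (ℚᵘ.≃-trans (ℚᵘ.+-congʳ ℚᵘ.1ℚᵘ (toℚᵘ-fromℕ n))
      (ℚᵘ.*≡* (cong (ℤ._* + 1) (cong (ℤ._+_ (+ 1)) (ℤ.*-identityʳ (+ n))))))

  <-fromℕ : ∀ x → ∃ λ K → x ℚ.< fromℕ K
  <-fromℕ x@(mkℚ n d _) = suc ℤ.∣ n ∣ ,
    ℚ.toℚᵘ-cancel-< (ℚᵘ.<-respʳ-≃ (ℚᵘ.≃-sym (toℚᵘ-fromℕ (suc ℤ.∣ n ∣)))
      (ℚᵘ.*<* (subst (ℤ._< + suc ℤ.∣ n ∣ ℤ.* + suc d) (sym (ℤ.*-identityʳ n))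
        (ℤ.<-≤-trans (n<1+∣n∣ n) (ℤ.+≤+ (ℕ.m≤m*n (suc ℤ.∣ n ∣) (suc d)))))))
    where
    n<1+∣n∣ : ∀ i → i ℤ.< + suc ℤ.∣ i ∣
    n<1+∣n∣ (+ i)     = ℤ.+<+ (ℕ.n<1+n i)
    n<1+∣n∣ -[1+ i ] = ℤ.-<+

  ½^-small : 0ℚ ℚ.< ε → ∃ λ N → ½^ N ℚ.< ε
  ½^-small {ε} 0<ε with split (ℚ.positive⁻¹ 1ℚ) 0<ε
  ... | ε⁻¹ , 0<ε⁻¹ , ε⁻¹ε≡1 with <-fromℕ ε⁻¹
  ... | K , ε⁻¹<K = K , ℚ.*-cancelˡ-<-nonNeg (fromℕ K) {{ℚ.nonNegative 0≤K}}
    (ℚ.≤-<-trans (n*½^n≤1 K)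
      (subst (ℚ._< fromℕ K ℚ.* ε) ε⁻¹ε≡1 (ℚ.*-monoˡ-<-pos ε {{ℚ.positive 0<ε}} ε⁻¹<K)))
    where 0≤K = ℚ.<⇒≤ (ℚ.<-trans 0<ε⁻¹ ε⁻¹<K)

  cube : ℚ → ℚ
  cube a = a ℚ.* a ℚ.* a

  cube≡ : ∀ c → cube c ≡ c ℚ.* (c ℚ.* (c ℚ.* 1ℚ))
  cube≡ = solve 1 (λ c → c :* c :* c := c :* (c :* (c :* con 1ℚ))) refl

  cube-gap : ∀ a b → 0ℚ ℚ.< ε → ε ℚ.≤ a ℚ.- b → cube ε ℚ.≤ 4ℚ ℚ.* (cube a ℚ.- cube b)
  cube-gap {ε} a b 0<ε ε≤d = ℚ.≤-trans ε³≤d³ (from-diff (subst (0ℚ ℚ.≤_)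
      (solve 2 (λ a b → con 3ℚ :* ((a :- b) :* ((a :+ b) :* (a :+ b)))
         := con 4ℚ :* (a :* a :* a :- b :* b :* b) :- (a :- b) :* (a :- b) :* (a :- b))
        refl a b)
      (0≤* (ℚ.<⇒≤ (ℚ.positive⁻¹ 3ℚ)) (0≤* 0≤d (0≤sq (a ℚ.+ b))))))
    where
    0≤ε = ℚ.<⇒≤ 0<ε
    0≤d = ℚ.≤-trans 0≤ε ε≤d
    ε³≤d³ : cube ε ℚ.≤ cube (a ℚ.- b)
    ε³≤d³ = *-mono-≤ (0≤* 0≤ε 0≤ε) (*-mono-≤ 0≤ε ε≤d 0≤ε ε≤d) 0≤ε ε≤d

  -- The inverse of cubing is uniformly continuous.
  cube-reflects : ∀ a b → 0ℚ ℚ.< ε → ∣ cube a ℚ.- cube b ∣ ℚ.< ¼ ℚ.* cube ε → ∣ a ℚ.- b ∣ ℚ.< ε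
  cube-reflects {ε} a b 0<ε h = ∣-∣< a b (below a b h)
    (below b a (subst (ℚ._< ¼ ℚ.* cube ε) (∣-∣-comm (cube a) (cube b)) h))
    where
    below : ∀ a b → ∣ cube a ℚ.- cube b ∣ ℚ.< ¼ ℚ.* cube ε → a ℚ.- b ℚ.< ε
    below a b h with (a ℚ.- b) ℚ.<? ε
    ... | yes p = p
    ... | no ¬p = contradiction
      (ℚ.<-≤-trans
        (ℚ.*-monoʳ-<-pos 4ℚ (ℚ.≤-<-trans (a≤∣a∣ (cube a ℚ.- cube b)) h))
        (subst (ℚ._≤ 4ℚ ℚ.* (cube a ℚ.- cube b))
          (solve 1 (λ c → c := con 4ℚ :* (con ¼ :* c)) refl (cube ε))
          (cube-gap a b 0<ε (ℚ.≮⇒≥ ¬p))))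
      (ℚ.<-irrefl refl)

  record Bracket (x B w : ℚ) : Set where
    field
      lo hi : ℚ
      width : hi ℚ.- lo ≡ w
      0≤w   : 0ℚ ℚ.≤ w
      -B≤lo : ℚ.- B ℚ.≤ lo
      hi≤B  : hi ℚ.≤ B
      lo³≤x : cube lo ℚ.≤ x
      x≤hi³ : x ℚ.≤ cube hi

    lo≤hi : lo ℚ.≤ hi
    lo≤hi = from-diff (subst (0ℚ ℚ.≤_) (sym width) 0≤w)

  bisect : ∀ {x B w} → Bracket x B w → Bracket x B (½ ℚ.* w)
  bisect {x} {B} {w} I = go (ℚ.≤-total (cube mid) x)
    where
    open Bracket I
    mid = ½ ℚ.* (lo ℚ.+ hi)
    0≤½w = 0≤* (ℚ.<⇒≤ (ℚ.positive⁻¹ ½)) 0≤w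
    upper : hi ℚ.- mid ≡ ½ ℚ.* w
    upper = trans (solve 2 (λ l h → h :- con ½ :* (l :+ h) := con ½ :* (h :- l)) refl lo hi)
                  (cong (½ ℚ.*_) width)
    lower : mid ℚ.- lo ≡ ½ ℚ.* w
    lower = trans (solve 2 (λ l h → con ½ :* (l :+ h) :- l := con ½ :* (h :- l)) refl lo hi)
                  (cong (½ ℚ.*_) width)
    lo≤mid = from-diff (subst (0ℚ ℚ.≤_) (sym lower) 0≤½w)
    mid≤hi = from-diff (subst (0ℚ ℚ.≤_) (sym upper) 0≤½w)
    go : _ → Bracket x B (½ ℚ.* w)
    go (inj₁ mid³≤x) = record
      { lo = mid ; hi = hi ; width = upper ; 0≤w = 0≤½w ; -B≤lo = ℚ.≤-trans -B≤lo lo≤mid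
      ; hi≤B = hi≤B ; lo³≤x = mid³≤x ; x≤hi³ = x≤hi³ }
    go (inj₂ x≤mid³) = record
      { lo = lo ; hi = mid ; width = lower ; 0≤w = 0≤½w ; -B≤lo = -B≤lo
      ; hi≤B = ℚ.≤-trans mid≤hi hi≤B ; lo³≤x = lo³≤x ; x≤hi³ = x≤mid³ }

  bisections : ∀ {x B w} n → Bracket x B w → Bracket x B (½^ n ℚ.* w)
  bisections {x} {B} {w} zero    I = subst (Bracket x B) (sym (ℚ.*-identityˡ w)) I
  bisections {x} {B} {w} (suc n) I =
    subst (Bracket x B) (sym (ℚ.*-assoc ½ (½^ n) w)) (bisect (bisections n I))

  bracket-error : ∀ {x B w} (I : Bracket x B w) →
                  ∣ cube (Bracket.lo I) ℚ.- x ∣ ℚ.≤ w ℚ.* (3ℚ ℚ.* (B ℚ.* B))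
  bracket-error {x} {B} {w} I = subst (ℚ._≤ w ℚ.* (3ℚ ℚ.* (B ℚ.* B)))
      (trans (sym (ℚ.0≤p⇒∣p∣≡p (to-diff lo³≤x))) (∣-∣-comm x (cube lo)))
      (ℚ.≤-trans (ℚ.+-monoˡ-≤ (ℚ.- cube lo) x≤hi³)
        (subst (ℚ._≤ w ℚ.* (3ℚ ℚ.* (B ℚ.* B))) (sym factor)
          (ℚ.*-monoˡ-≤-nonNeg w {{ℚ.nonNegative 0≤w}} quadratic)))
    where
    open Bracket I
    ∣lo∣≤B : ∣ lo ∣ ℚ.≤ B
    ∣lo∣≤B = ∣∣≤ (ℚ.≤-trans lo≤hi hi≤B)
      (subst (ℚ.- lo ℚ.≤_) (solve 1 (λ B → :- (:- B) := B) refl B) (ℚ.neg-antimono-≤ -B≤lo))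
    ∣hi∣≤B : ∣ hi ∣ ℚ.≤ B
    ∣hi∣≤B = ∣∣≤ hi≤B (subst (ℚ.- hi ℚ.≤_) (solve 1 (λ B → :- (:- B) := B) refl B)
      (ℚ.neg-antimono-≤ (ℚ.≤-trans -B≤lo lo≤hi)))
    prod : ∣ a ∣ ℚ.≤ B → ∣ b ∣ ℚ.≤ B → a ℚ.* b ℚ.≤ B ℚ.* B
    prod {a} {b} h k = ℚ.≤-trans (a≤∣a∣ (a ℚ.* b)) (subst (ℚ._≤ B ℚ.* B)
      (sym (ℚ.∣p*q∣≡∣p∣*∣q∣ a b)) (*-mono-≤ (ℚ.0≤∣p∣ a) h (ℚ.0≤∣p∣ b) k))
    quadratic : hi ℚ.* hi ℚ.+ hi ℚ.* lo ℚ.+ lo ℚ.* lo ℚ.≤ 3ℚ ℚ.* (B ℚ.* B)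
    quadratic = subst (hi ℚ.* hi ℚ.+ hi ℚ.* lo ℚ.+ lo ℚ.* lo ℚ.≤_)
      (solve 1 (λ s → s :+ s :+ s := con 3ℚ :* s) refl (B ℚ.* B))
      (ℚ.+-mono-≤ (ℚ.+-mono-≤ (prod ∣hi∣≤B ∣hi∣≤B) (prod ∣hi∣≤B ∣lo∣≤B)) (prod ∣lo∣≤B ∣lo∣≤B))
    factor : cube hi ℚ.- cube lo ≡ w ℚ.* (hi ℚ.* hi ℚ.+ hi ℚ.* lo ℚ.+ lo ℚ.* lo)
    factor = trans
      (solve 2 (λ h l → h :* h :* h :- l :* l :* l := (h :- l) :* (h :* h :+ h :* l :+ l :* l))
        refl hi lo)
      (cong (ℚ._* (hi ℚ.* hi ℚ.+ hi ℚ.* lo ℚ.+ lo ℚ.* lo)) width)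

  bound : ℚ → ℚ
  bound x = ∣ x ∣ ℚ.+ 1ℚ

  initial : ∀ x → Bracket x (bound x) (bound x ℚ.+ bound x)
  initial x = record
    { lo = ℚ.- B ; hi = B
    ; width = solve 1 (λ B → B :- (:- B) := B :+ B) refl B
    ; 0≤w = 0≤+ 0≤B 0≤B ; -B≤lo = ℚ.≤-refl ; hi≤B = ℚ.≤-refl
    ; lo³≤x = subst₂ ℚ._≤_ (solve 1 (λ B → :- (B :* B :* B) := (:- B) :* (:- B) :* (:- B)) refl B)
        (solve 1 (λ x → :- (:- x) := x) refl x)
        (ℚ.neg-antimono-≤ (ℚ.≤-trans
          (subst (ℚ.- x ℚ.≤_) (ℚ.∣-p∣≡∣p∣ x) (a≤∣a∣ (ℚ.- x))) ∣x∣≤B³))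
    ; x≤hi³ = ℚ.≤-trans (a≤∣a∣ x) ∣x∣≤B³ }
    where
    t = ∣ x ∣
    B = t ℚ.+ 1ℚ
    0≤t = ℚ.0≤∣p∣ x
    0≤1 = ℚ.<⇒≤ (ℚ.positive⁻¹ 1ℚ)
    0≤B = 0≤+ 0≤t 0≤1
    ∣x∣≤B³ : t ℚ.≤ cube B
    ∣x∣≤B³ = from-diff (subst (0ℚ ℚ.≤_)
      (solve 1 (λ t → t :* t :* t :+ con 3ℚ :* (t :* t) :+ (t :+ t :+ con 1ℚ)
                  := (t :+ con 1ℚ) :* (t :+ con 1ℚ) :* (t :+ con 1ℚ) :- t) refl t)
      (0≤+ (0≤+ (0≤* (0≤* 0≤t 0≤t) 0≤t) (0≤* (ℚ.<⇒≤ (ℚ.positive⁻¹ 3ℚ)) (0≤* 0≤t 0≤t)))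
           (0≤+ (0≤+ 0≤t 0≤t) 0≤1)))

  error-factor : ℚ → ℚ
  error-factor x = (bound x ℚ.+ bound x) ℚ.* (3ℚ ℚ.* (bound x ℚ.* bound x))

  0<error-factor : ∀ x → 0ℚ ℚ.< error-factor x
  0<error-factor x = 0<* (ℚ.+-mono-< 0<B 0<B) (0<* (ℚ.positive⁻¹ 3ℚ) (0<* 0<B 0<B))
    where
    0<B : 0ℚ ℚ.< bound x
    0<B = ℚ.+-mono-≤-< (ℚ.0≤∣p∣ x) (ℚ.positive⁻¹ 1ℚ)

  bisections-error : ∀ x n → let I = bisections n (initial x) in
    ½^ n ℚ.< δ → ∣ cube (Bracket.lo I) ℚ.- x ∣ ℚ.< δ ℚ.* error-factor x
  bisections-error {δ} x n ½^n<δ = ℚ.≤-<-trans (bracket-error (bisections n (initial x)))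
    (subst (ℚ._< δ ℚ.* error-factor x)
      (sym (ℚ.*-assoc (½^ n) (bound x ℚ.+ bound x) (3ℚ ℚ.* (bound x ℚ.* bound x))))
      (ℚ.*-monoˡ-<-pos (error-factor x) {{ℚ.positive (0<error-factor x)}} ½^n<δ))

  abstract
    cbrt-approx : ∀ x → 0ℚ ℚ.< ε → ∃ λ c → ∣ cube c ℚ.- x ∣ ℚ.< ε
    cbrt-approx {ε} x 0<ε =
      let δ , 0<δ , δ*≡ε = split 0<ε (0<error-factor x)
          n , ½^n<δ      = ½^-small 0<δ
      in Bracket.lo (bisections n (initial x)) ,
         subst (∣ cube (Bracket.lo (bisections n (initial x))) ℚ.- x ∣ ℚ.<_) δ*≡ε
           (bisections-error x n ½^n<δ)

  EventuallyBounded : (ℕ → ℚ) → ℚ → Set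
  EventuallyBounded f B = ∃ λ N → ∀ {n} → N ℕ.≤ n → ∣ f n ∣ ℚ.< B

  EventuallyClose : (ℕ → ℚ) → ℚ → Set
  EventuallyClose f δ = ∃ λ N → ∀ {m n} → N ℕ.≤ m → N ℕ.≤ n → ∣ f m ℚ.- f n ∣ ℚ.< δ

  abstract
    cauchy-const : ∀ a → Cauchy (λ _ → a)
    cauchy-const a {ε} 0<ε =
      0 , λ _ _ → subst (ℚ._< ε) (cong ∣_∣ (sym (ℚ.+-inverseʳ a))) 0<ε

    cauchy-neg : ∀ f → Cauchy f → Cauchy (λ n → ℚ.- f n)
    cauchy-neg f cf {ε} 0<ε with cf 0<ε
    ... | N , p = N , λ {m} {n} i j →
      subst (ℚ._< ε) (∣-∣-neg (f n) (f m)) (p j i)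

    cauchy-+ : ∀ f g → Cauchy f → Cauchy g → Cauchy (λ n → f n ℚ.+ g n)
    cauchy-+ f g cf cg {ε} 0<ε with cf (0<½* 0<ε) | cg (0<½* 0<ε)
    ... | M , p | N , q = M ℕ.⊔ N , λ {m} {n} i j → ℚ.≤-<-trans
      (∣-∣-+ (f m) (f n) (g m) (g n))
      (subst (∣ f m ℚ.- f n ∣ ℚ.+ ∣ g m ℚ.- g n ∣ ℚ.<_) (½+½ ε)
        (ℚ.+-mono-< (p (ℕ.m⊔n≤o⇒m≤o M N i) (ℕ.m⊔n≤o⇒m≤o M N j))
                    (q (ℕ.m⊔n≤o⇒n≤o M N i) (ℕ.m⊔n≤o⇒n≤o M N j))))

    cauchy-bounded : ∀ f → Cauchy f → ∃ λ B → 0ℚ ℚ.< B × EventuallyBounded f B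
    cauchy-bounded f cf = bounded (cf (ℚ.positive⁻¹ 1ℚ))
      where
      bounded : EventuallyClose f 1ℚ → ∃ λ B → 0ℚ ℚ.< B × EventuallyBounded f B
      bounded (N , p) =
        1ℚ ℚ.+ ∣ f N ∣ , ℚ.+-mono-<-≤ (ℚ.positive⁻¹ 1ℚ) (ℚ.0≤∣p∣ (f N)) , N ,
        λ {n} i → ℚ.≤-<-trans (∣-∣-bound (f n) (f N)) (ℚ.+-monoˡ-< ∣ f N ∣ (p i ℕ.≤-refl))

    close-* : ∀ f g A B δ → 0ℚ ℚ.< δ →
      EventuallyBounded f A → EventuallyBounded g B →
      EventuallyClose f δ → EventuallyClose g δ →
      EventuallyClose (λ n → f n ℚ.* g n) (δ ℚ.* (B ℚ.+ A))
    close-* f g A B δ 0<δ (N₁ , f<A) (N₂ , g<B) (N₃ , p) (N₄ , q) =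
      (N₁ ℕ.⊔ N₂) ℕ.⊔ (N₃ ℕ.⊔ N₄) , λ {m} {n} i j →
        ℚ.≤-<-trans (∣-∣-* (f m) (f n) (g m) (g n))
          (subst (∣ (f m ℚ.- f n) ℚ.* g m ∣ ℚ.+ ∣ (g m ℚ.- g n) ℚ.* f n ∣ ℚ.<_)
            (sym (ℚ.*-distribˡ-+ δ B A))
            (ℚ.+-mono-<
              (∣*∣< (f m ℚ.- f n) (g m) 0<δ (p (≥N₃ i) (≥N₃ j)) (g<B (≥N₂ i)))
              (∣*∣< (g m ℚ.- g n) (f n) 0<δ (q (≥N₄ i) (≥N₄ j)) (f<A (≥N₁ j)))))
      where
      ≥N₁ : ∀ {n} → (N₁ ℕ.⊔ N₂) ℕ.⊔ (N₃ ℕ.⊔ N₄) ℕ.≤ n → N₁ ℕ.≤ n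
      ≥N₁ i = ℕ.m⊔n≤o⇒m≤o N₁ N₂ (ℕ.m⊔n≤o⇒m≤o (N₁ ℕ.⊔ N₂) (N₃ ℕ.⊔ N₄) i)
      ≥N₂ : ∀ {n} → (N₁ ℕ.⊔ N₂) ℕ.⊔ (N₃ ℕ.⊔ N₄) ℕ.≤ n → N₂ ℕ.≤ n
      ≥N₂ i = ℕ.m⊔n≤o⇒n≤o N₁ N₂ (ℕ.m⊔n≤o⇒m≤o (N₁ ℕ.⊔ N₂) (N₃ ℕ.⊔ N₄) i)
      ≥N₃ : ∀ {n} → (N₁ ℕ.⊔ N₂) ℕ.⊔ (N₃ ℕ.⊔ N₄) ℕ.≤ n → N₃ ℕ.≤ n
      ≥N₃ i = ℕ.m⊔n≤o⇒m≤o N₃ N₄ (ℕ.m⊔n≤o⇒n≤o (N₁ ℕ.⊔ N₂) (N₃ ℕ.⊔ N₄) i)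
      ≥N₄ : ∀ {n} → (N₁ ℕ.⊔ N₂) ℕ.⊔ (N₃ ℕ.⊔ N₄) ℕ.≤ n → N₄ ℕ.≤ n
      ≥N₄ i = ℕ.m⊔n≤o⇒n≤o N₃ N₄ (ℕ.m⊔n≤o⇒n≤o (N₁ ℕ.⊔ N₂) (N₃ ℕ.⊔ N₄) i)

    cauchy-* : ∀ f g → Cauchy f → Cauchy g → Cauchy (λ n → f n ℚ.* g n)
    cauchy-* f g cf cg {ε} 0<ε =
      let A , 0<A , f<A  = cauchy-bounded f cf
          B , 0<B , g<B  = cauchy-bounded g cg
          δ , 0<δ , δ*≡ε = split 0<ε (ℚ.+-mono-< 0<B 0<A)
      in subst (EventuallyClose (λ n → f n ℚ.* g n)) δ*≡ε
           (close-* f g A B δ 0<δ f<A g<B (cf 0<δ) (cg 0<δ))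

    -- A sequence getting arbitrarily close to a Cauchy sequence is Cauchy.
    cauchy-close : ∀ f g → Cauchy f → (∀ n → ∣ g n ℚ.- f n ∣ ℚ.< ½^ n) → Cauchy g
    cauchy-close f g cf g~f {ε} 0<ε =
      close (cf (0<½* 0<ε)) (½^-small (0<½* (0<½* 0<ε)))
      where
      near : ∀ {K n} → ½^ K ℚ.< ½ ℚ.* (½ ℚ.* ε) → K ℕ.≤ n →
             ∣ g n ℚ.- f n ∣ ℚ.< ½ ℚ.* (½ ℚ.* ε)
      near {K} {n} q K≤n = ℚ.<-trans (g~f n) (ℚ.≤-<-trans (½^-antimono K≤n) q)

      close : EventuallyClose f (½ ℚ.* ε) → (∃ λ K → ½^ K ℚ.< ½ ℚ.* (½ ℚ.* ε)) →
              EventuallyClose g ε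
      close (M , p) (K , q) = M ℕ.⊔ K , λ {m} {n} i j → ℚ.≤-<-trans
        (ℚ.≤-trans (triangle (g m) (f m) (g n))
          (ℚ.+-monoʳ-≤ ∣ g m ℚ.- f m ∣ (triangle (f m) (f n) (g n))))
        (subst (∣ g m ℚ.- f m ∣ ℚ.+ (∣ f m ℚ.- f n ∣ ℚ.+ ∣ f n ℚ.- g n ∣) ℚ.<_) (¼+½+¼ ε)
          (ℚ.+-mono-< (near q (ℕ.m⊔n≤o⇒n≤o M K i))
            (ℚ.+-mono-< (p (ℕ.m⊔n≤o⇒m≤o M K i) (ℕ.m⊔n≤o⇒m≤o M K j))
              (subst (ℚ._< ½ ℚ.* (½ ℚ.* ε)) (∣-∣-comm (g n) (f n))
                (near q (ℕ.m⊔n≤o⇒n≤o M K j))))))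

    close⇒limit : ∀ (f g : ℕ → ℚ) → (∀ n → ∣ g n ℚ.- f n ∣ ℚ.< ½^ n) → 0ℚ ℚ.< ε →
      ∃ λ N → ∀ {n} → N ℕ.≤ n → ∣ g n ℚ.- f n ∣ ℚ.< ε
    close⇒limit {ε} f g g~f 0<ε =
      let K , q = ½^-small 0<ε
      in K , λ {n} K≤n → ℚ.<-trans (g~f n) (ℚ.≤-<-trans (½^-antimono K≤n) q)

    cauchy-cbrt : ∀ f → Cauchy (λ n → cube (f n)) → Cauchy f
    cauchy-cbrt f cf³ {ε} 0<ε with cf³ (0<* (ℚ.positive⁻¹ ¼) (0<* (0<* 0<ε 0<ε) 0<ε))
    ... | N , p = N , λ {m} {n} i j → cube-reflects (f m) (f n) 0<ε (p i j)

open ℚ-Lemmas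

-- Real numbers as Cauchy sequences of rationals, with _≈_ as their equality.
record ℝ : Set where
  constructor mkℝ
  field
    seq    : ℕ → ℚ
    cauchy : Cauchy seq

open ℝ public

infix 4 _≈_ _#_

record _≈_ (x y : ℝ) : Set where
  constructor mk≈
  field
    converge : ∀ {ε} → 0ℚ ℚ.< ε →
      ∃ λ N → ∀ {n} → N ℕ.≤ n → ∣ seq x n ℚ.- seq y n ∣ ℚ.< ε

-- Apartness, the positive form of ≠: being eventually bounded away from
-- each other.  Classically it is equivalent to ¬ (x ≈ y).
record _#_ (x y : ℝ) : Set where
  constructor mk#
  field
    {gap}   : ℚ
    gap-pos : 0ℚ ℚ.< gap
    from    : ℕ
    apart   : ∀ {n} → from ℕ.≤ n → gap ℚ.≤ ∣ seq x n ℚ.- seq y n ∣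

open _≈_ public

fromℚ : ℚ → ℝ
fromℚ a = mkℝ (λ _ → a) (cauchy-const a)

infix  8 -_
infixl 7 _*_
infixl 6 _+_

_+_ : ℝ → ℝ → ℝ
x + y = mkℝ (λ n → seq x n ℚ.+ seq y n) (cauchy-+ (seq x) (seq y) (cauchy x) (cauchy y))

_*_ : ℝ → ℝ → ℝ
x * y = mkℝ (λ n → seq x n ℚ.* seq y n) (cauchy-* (seq x) (seq y) (cauchy x) (cauchy y))

-_ : ℝ → ℝ
- x = mkℝ (λ n → ℚ.- seq x n) (cauchy-neg (seq x) (cauchy x))

ℝ-rawRing : RawRing 0ℓ 0ℓ
ℝ-rawRing = record
  { _≈_ = _≈_ ; _+_ = _+_ ; _*_ = _*_ ; -_ = -_ ; 0# = fromℚ 0ℚ ; 1# = fromℚ 1ℚ }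

0ℝ 3ℝ : ℝ
0ℝ = fromℚ 0ℚ
3ℝ = fromℚ 3ℚ

open RawSemiringDefs (RawRing.rawSemiring ℝ-rawRing) public using (_^_)

-- The real cube root, as the limit of rationals whose cubes approximate the
-- terms of x.
cbrt : ℝ → ℝ
cbrt x = mkℝ root
  (cauchy-cbrt root (cauchy-close (seq x) (λ n → cube (root n)) (cauchy x) root³-close))
  where
  root : ℕ → ℚ
  root n = proj₁ (cbrt-approx (seq x n) (0<½^ n))

  root³-close : ∀ n → ∣ cube (root n) ℚ.- seq x n ∣ ℚ.< ½^ n
  root³-close n = proj₂ (cbrt-approx (seq x n) (0<½^ n))

cbrt-cubed : ∀ x → cbrt x ^ 3 ≈ x
cbrt-cubed x = mk≈ (close⇒limit (seq x) (seq (cbrt x ^ 3)) root³-close)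
  where
  root³-close : ∀ n → ∣ seq (cbrt x ^ 3) n ℚ.- seq x n ∣ ℚ.< ½^ n
  root³-close n = subst (λ t → ∣ t ℚ.- seq x n ∣ ℚ.< ½^ n) (cube≡ (seq (cbrt x) n))
    (proj₂ (cbrt-approx (seq x n) (0<½^ n)))

record ℂ : Set where
  constructor mkℂ
  field
    re im : ℝ

open ℂ public

fromℝ : ℝ → ℂ
fromℝ x = mkℂ x 0ℝ

infix 4 _≈ᶜ_

_≈ᶜ_ : ℂ → ℂ → Set
z ≈ᶜ w = re z ≈ re w × im z ≈ im w

infix  8 -ᶜ_
infixl 7 _*ᶜ_
infixl 6 _+ᶜ_

_+ᶜ_ : ℂ → ℂ → ℂ
z +ᶜ w = mkℂ (re z + re w) (im z + im w)

_*ᶜ_ : ℂ → ℂ → ℂ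
z *ᶜ w = mkℂ (re z * re w + - (im z * im w)) (re z * im w + im z * re w)

-ᶜ_ : ℂ → ℂ
-ᶜ z = mkℂ (- re z) (- im z)

ℂ-rawRing : RawRing 0ℓ 0ℓ
ℂ-rawRing = record
  { _≈_ = _≈ᶜ_ ; _+_ = _+ᶜ_ ; _*_ = _*ᶜ_ ; -_ = -ᶜ_
  ; 0# = fromℝ 0ℝ ; 1# = fromℝ (fromℚ 1ℚ) }

open RawSemiringDefs (RawRing.rawSemiring ℂ-rawRing) public using () renaming (_^_ to _^ᶜ_)

-- The value of x³ + p x² + q x + r at a complex number.
cubic : (p q r : ℝ) → ℂ → ℂ
cubic p q r z = z ^ᶜ 3 +ᶜ fromℝ p *ᶜ z ^ᶜ 2 +ᶜ fromℝ q *ᶜ z +ᶜ fromℝ r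

record IsRamanujanCubic (p q r : ℝ) : Set where
  field
    r#0       : r # 0ℝ
    realZeros : ∀ z → cubic p q r z ≈ᶜ fromℝ 0ℝ → im z ≈ 0ℝ
    relation  : p * cbrt r + 3ℝ * cbrt r ^ 2 + q ≈ 0ℝ

{-# OPTIONS --safe #-}

-- From s = r^{1/3} the parameter is h = p/s, and the relation gives q.
-- Conversely, the cubic with parameters h, s is K - hs G with K = z³ - 3s²z + s³
-- and G = sz - z².  At a zero z = x + iy, multiplying by the conjugate of G makes
-- the h-term real, so Im (K conj G) = 0.  This imaginary part equals
-- -y(D² + s²y²) with D = x² + y² + s² - sx, and times -y it is the sum of squares
-- (yD)² + (sy²)².  Hence sy² = 0, and y = 0 since s is invertible.

module Submission where

open import Defs
open import Data.Nat.Base as ℕ using (ℕ)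
import Data.Nat.Properties as ℕ
open import Data.Product.Base using (∃; ∃₂; _×_; _,_)
open import Data.Rational.Base as ℚ using (ℚ; 0ℚ; 1ℚ; ½; ∣_∣)
import Data.Rational.Properties as ℚ
open import Data.Rational.Solver using (module +-*-Solver)
open import Function.Bundles using (_⇔_; mk⇔)
open import Level using (0ℓ)
open import Relation.Binary.Bundles using (Setoid)
open import Relation.Binary.PropositionalEquality
  using (_≡_; refl; sym; trans; cong; cong₂; subst; subst₂)
import Relation.Binary.Reasoning.Setoid as SetoidReasoning
open import Relation.Nullary using (yes; no; contradiction)

open ℚ-Lemmas
open +-*-Solver using (Polynomial; solve; _:=_; _:+_; _:*_; _:-_; :-_; con)

private
  variable
    P Q R : ℕ → Set
    x x′ y y′ z : ℝ
    u u′ v v′ : ℂ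
    ε : ℚ

-- Equality of reals: equivalence, ring operations, cubes and squares.

Eventually : (ℕ → Set) → Set
Eventually P = ∃ λ N → ∀ {n} → N ℕ.≤ n → P n

map : (∀ {n} → P n → Q n) → Eventually P → Eventually Q
map f (N , p) = N , λ i → f (p i)

zipWith : (∀ {n} → P n → Q n → R n) → Eventually P → Eventually Q → Eventually R
zipWith f (M , p) (N , q) =
  M ℕ.⊔ N , λ i → f (p (ℕ.m⊔n≤o⇒m≤o M N i)) (q (ℕ.m⊔n≤o⇒n≤o M N i))

x-0≡x : ∀ a → a ℚ.- 0ℚ ≡ a
x-0≡x = ℚ.+-identityʳ

1ℝ : ℝ
1ℝ = fromℚ 1ℚ

eventually-≡⇒≈ : Eventually (λ n → seq x n ≡ seq y n) → x ≈ y
eventually-≡⇒≈ {x} {y} h = mk≈ λ {ε} 0<ε →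
  map (λ {n} e → subst (ℚ._< ε)
    (sym (cong ∣_∣ (trans (cong (ℚ._- seq y n) e) (ℚ.+-inverseʳ (seq y n))))) 0<ε) h

-- The operations on reals act termwise, so a polynomial identity over `ℚ`, usually found by the
-- ring solver, passes directly to `ℝ`.
pointwise : (∀ n → seq x n ≡ seq y n) → x ≈ y
pointwise h = eventually-≡⇒≈ (0 , λ {n} _ → h n)

≈-refl : x ≈ x
≈-refl = pointwise λ _ → refl

≈-sym : x ≈ y → y ≈ x
≈-sym {x} {y} x≈y = mk≈ λ {ε} 0<ε →
  map (λ {n} → subst (ℚ._< ε) (∣-∣-comm (seq x n) (seq y n))) (converge x≈y 0<ε)

≈-trans : x ≈ y → y ≈ z → x ≈ z
≈-trans {x} {y} {z} x≈y y≈z = mk≈ λ {ε} 0<ε →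
  zipWith (λ {n} h k → ℚ.≤-<-trans (triangle (seq x n) (seq y n) (seq z n))
      (subst (∣ seq x n ℚ.- seq y n ∣ ℚ.+ ∣ seq y n ℚ.- seq z n ∣ ℚ.<_) (½+½ ε)
        (ℚ.+-mono-< h k)))
    (converge x≈y (0<½* 0<ε)) (converge y≈z (0<½* 0<ε))

≈-setoid : Setoid 0ℓ 0ℓ
≈-setoid = record
  { Carrier = ℝ ; _≈_ = _≈_
  ; isEquivalence = record { refl = ≈-refl ; sym = ≈-sym ; trans = ≈-trans } }

open SetoidReasoning ≈-setoid

+-cong : x ≈ x′ → y ≈ y′ → x + y ≈ x′ + y′
+-cong {x} {x′} {y} {y′} x≈x′ y≈y′ = mk≈ λ {ε} 0<ε →
  zipWith (λ {n} h k → ℚ.≤-<-trans (∣-∣-+ (seq x n) (seq x′ n) (seq y n) (seq y′ n))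
      (subst (∣ seq x n ℚ.- seq x′ n ∣ ℚ.+ ∣ seq y n ℚ.- seq y′ n ∣ ℚ.<_) (½+½ ε)
        (ℚ.+-mono-< h k)))
    (converge x≈x′ (0<½* 0<ε)) (converge y≈y′ (0<½* 0<ε))

neg-cong : x ≈ x′ → - x ≈ - x′
neg-cong {x} {x′} x≈x′ = mk≈ λ {ε} 0<ε →
  map (λ {n} → subst (ℚ._< ε) (∣-∣-neg (seq x′ n) (seq x n))) (converge (≈-sym x≈x′) 0<ε)

*-cong : x ≈ x′ → y ≈ y′ → x * y ≈ x′ * y′
*-cong {x} {x′} {y} {y′} x≈x′ y≈y′ = mk≈ λ {ε} 0<ε →
  let A , 0<A , x′<A = cauchy-bounded (seq x′) (cauchy x′)
      B , 0<B , y<B  = cauchy-bounded (seq y) (cauchy y)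
      -- `δ` is `ε / (B + A)`: the errors `δ * B` and `δ * A` of the two factors add up to `ε`.
      δ , 0<δ , δ*≡ε = split 0<ε (ℚ.+-mono-< 0<B 0<A)
  in zipWith (λ {n} h k → ℚ.≤-<-trans (∣-∣-* (seq x n) (seq x′ n) (seq y n) (seq y′ n))
         (subst (∣ (seq x n ℚ.- seq x′ n) ℚ.* seq y n ∣
                   ℚ.+ ∣ (seq y n ℚ.- seq y′ n) ℚ.* seq x′ n ∣ ℚ.<_)
           (trans (sym (ℚ.*-distribˡ-+ δ B A)) δ*≡ε) (ℚ.+-mono-< h k)))
       (zipWith (λ {n} → ∣*∣< (seq x n ℚ.- seq x′ n) (seq y n) 0<δ) (converge x≈x′ 0<δ) y<B)
       (zipWith (λ {n} → ∣*∣< (seq y n ℚ.- seq y′ n) (seq x′ n) 0<δ) (converge y≈y′ 0<δ) x′<A)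

cubed-cong : x ≈ y → x ^ 3 ≈ y ^ 3
cubed-cong x≈y = *-cong x≈y (*-cong x≈y (*-cong x≈y ≈-refl))

squared-cong : x ≈ y → x ^ 2 ≈ y ^ 2
squared-cong x≈y = *-cong x≈y (*-cong x≈y ≈-refl)

-- Cubes within `ε³/4` of each other have roots within `ε`, which is the estimate `cube-reflects`.
-- This uniqueness of real cube roots later identifies `cbrt r` with `s`.
cubed-injective : x ^ 3 ≈ y ^ 3 → x ≈ y
cubed-injective {x} {y} x³≈y³ = mk≈ λ {ε} 0<ε →
  map (λ {n} h → cube-reflects (seq x n) (seq y n) 0<ε
        (subst (ℚ._< ¼ ℚ.* cube ε)
          (sym (cong₂ (λ s t → ∣ s ℚ.- t ∣) (cube≡ (seq x n)) (cube≡ (seq y n)))) h))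
    (converge x³≈y³ (0<* (ℚ.positive⁻¹ ¼) (0<* (0<* 0<ε 0<ε) 0<ε)))

-- The hypothesis is taken at tolerance `ε²`: a term with `∣ a ∣` at least `ε` would make the sum at
-- least `ε²`. The case split is on rational terms, where the order is decidable.
sum-of-squares≈0 : x * x + y * y ≈ 0ℝ → x ≈ 0ℝ
sum-of-squares≈0 {x} {y} h = mk≈ λ {ε} 0<ε →
  map (λ {n} k → subst (λ t → ∣ t ∣ ℚ.< ε) (sym (x-0≡x (seq x n)))
        (small 0<ε (seq x n) (seq y n) (subst (λ t → ∣ t ∣ ℚ.< ε ℚ.* ε) (x-0≡x _) k)))
    (converge h (0<* 0<ε 0<ε))
  where
  small : 0ℚ ℚ.< ε → ∀ a b → ∣ a ℚ.* a ℚ.+ b ℚ.* b ∣ ℚ.< ε ℚ.* ε → ∣ a ∣ ℚ.< ε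
  small {ε} 0<ε a b k with ∣ a ∣ ℚ.<? ε
  ... | yes ∣a∣<ε = ∣a∣<ε
  ... | no ∣a∣≮ε = contradiction (ℚ.≤-<-trans ε²≤a²+b² k) (ℚ.<-irrefl refl)
    where
    0≤ε = ℚ.<⇒≤ 0<ε
    ε≤∣a∣ = ℚ.≮⇒≥ ∣a∣≮ε
    ∣a∣²≡a² : ∣ a ∣ ℚ.* ∣ a ∣ ≡ a ℚ.* a
    ∣a∣²≡a² = trans (sym (ℚ.∣p*q∣≡∣p∣*∣q∣ a a)) (ℚ.0≤p⇒∣p∣≡p (0≤sq a))
    ε²≤a²+b² : ε ℚ.* ε ℚ.≤ ∣ a ℚ.* a ℚ.+ b ℚ.* b ∣
    ε²≤a²+b² = ℚ.≤-trans
      (subst₂ ℚ._≤_ (ℚ.+-identityʳ (ε ℚ.* ε)) (cong (ℚ._+ b ℚ.* b) ∣a∣²≡a²)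
        (ℚ.+-mono-≤ (*-mono-≤ 0≤ε ε≤∣a∣ 0≤ε ε≤∣a∣) (0≤sq b)))
      (a≤∣a∣ (a ℚ.* a ℚ.+ b ℚ.* b))

-- Invertibility and apartness from zero.

-- An explicit inverse turns cancellation into algebra. The next two lemmas show that having one
-- amounts to being apart from `0ℝ`.
Invertible : ℝ → Set
Invertible x = ∃ λ y → y * x ≈ 1ℝ

invertible⇒#0 : Invertible x → x # 0ℝ
invertible⇒#0 {x} (y , yx≈1) =
  let B , 0<B , y<B  = cauchy-bounded (seq y) (cauchy y)
      -- `γ` is `1/(2B)`. If `∣ a ∣` were below it, then `∣ a * b ∣` and `∣ 1 - b * a ∣` would both
      -- be below `½`, contradicting that `a * b` and `1 - b * a` sum to 1.
      γ , 0<γ , γB≡½ = split (ℚ.positive⁻¹ ½) 0<B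
      N , apart      = zipWith (λ {n} h k → subst (λ t → γ ℚ.≤ ∣ t ∣) (sym (x-0≡x (seq x n)))
                         (large 0<γ γB≡½ (seq x n) (seq y n) h k))
                         y<B (converge yx≈1 (ℚ.positive⁻¹ ½))
  in mk# 0<γ N apart
  where
  large : ∀ {γ B} → 0ℚ ℚ.< γ → γ ℚ.* B ≡ ½ → ∀ a b →
          ∣ b ∣ ℚ.< B → ∣ b ℚ.* a ℚ.- 1ℚ ∣ ℚ.< ½ → γ ℚ.≤ ∣ a ∣
  large {γ} {B} 0<γ γB≡½ a b b<B ba≈1 with ∣ a ∣ ℚ.<? γ
  ... | no ∣a∣≮γ = ℚ.≮⇒≥ ∣a∣≮γ
  ... | yes ∣a∣<γ = contradiction
    (ℚ.≤-<-trans
      (subst (ℚ._≤ ∣ 1ℚ ℚ.- b ℚ.* a ∣ ℚ.+ ∣ a ℚ.* b ∣)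
        (cong ∣_∣ (solve 2 (λ a b → (con 1ℚ :- b :* a) :+ a :* b := con 1ℚ) refl a b))
        (ℚ.∣p+q∣≤∣p∣+∣q∣ (1ℚ ℚ.- b ℚ.* a) (a ℚ.* b)))
      (ℚ.+-mono-<
        (subst (ℚ._< ½) (∣-∣-comm (b ℚ.* a) 1ℚ) ba≈1)
        (subst (∣ a ℚ.* b ∣ ℚ.<_) γB≡½ (∣*∣< a b 0<γ ∣a∣<γ b<B))))
    (ℚ.<-irrefl refl)

#0⇒invertible : x # 0ℝ → Invertible x
#0⇒invertible {x} (mk# {γ} 0<γ N apart) =
  -- From index `N` on, `N ⊔ n` is `n`, so the product is exactly 1 there.
  mkℝ inv inv-cauchy , eventually-≡⇒≈ (N , λ {n} N≤n →
    trans (cong (λ m → inv n ℚ.* seq x m) (sym (ℕ.m≤n⇒m⊔n≡n N≤n))) (inverse n))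
  where
  γ≤∣x∣ : ∀ n → γ ℚ.≤ ∣ seq x (N ℕ.⊔ n) ∣
  γ≤∣x∣ n = subst (λ t → γ ℚ.≤ ∣ t ∣) (x-0≡x _) (apart (ℕ.m≤m⊔n N n))

  nonZero : ∀ a → γ ℚ.≤ ∣ a ∣ → ℚ.NonZero a
  nonZero a γ≤∣a∣ = ℚ.≢-nonZero {a} λ { refl → ℚ.<-irrefl refl (ℚ.<-≤-trans 0<γ γ≤∣a∣) }

  -- The first N terms of x may vanish, so they are replaced by the N-th one.
  inv : ℕ → ℚ
  inv n = ℚ.1/_ (seq x (N ℕ.⊔ n)) {{nonZero (seq x (N ℕ.⊔ n)) (γ≤∣x∣ n)}}

  inverse : ∀ n → inv n ℚ.* seq x (N ℕ.⊔ n) ≡ 1ℚ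
  inverse n = ℚ.*-inverseˡ (seq x (N ℕ.⊔ n)) {{nonZero (seq x (N ℕ.⊔ n)) (γ≤∣x∣ n)}}

  -- Here `c` and `d` are the reciprocals of `a` and `b`, so `∣ c - d ∣` is `∣ b - a ∣ / ∣ a * b ∣`,
  -- and `∣ a * b ∣` is at least `γ²`.
  close : ∀ a b c d → γ ℚ.≤ ∣ a ∣ → γ ℚ.≤ ∣ b ∣ → c ℚ.* a ≡ 1ℚ → d ℚ.* b ≡ 1ℚ →
          ∣ b ℚ.- a ∣ ℚ.< γ ℚ.* γ ℚ.* ε → ∣ c ℚ.- d ∣ ℚ.< ε
  close a b c d γ≤∣a∣ γ≤∣b∣ ca≡1 db≡1 h =
    ℚ.*-cancelˡ-<-nonNeg (γ ℚ.* γ) {{ℚ.nonNegative (ℚ.<⇒≤ (0<* 0<γ 0<γ))}}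
      (ℚ.≤-<-trans
        (ℚ.*-monoʳ-≤-nonNeg ∣ c ℚ.- d ∣ {{ℚ.∣-∣-nonNeg (c ℚ.- d)}}
          (*-mono-≤ 0≤γ γ≤∣a∣ 0≤γ γ≤∣b∣))
        (subst (ℚ._< _) (sym clear) h))
    where
    0≤γ = ℚ.<⇒≤ 0<γ
    clear : ∣ a ∣ ℚ.* ∣ b ∣ ℚ.* ∣ c ℚ.- d ∣ ≡ ∣ b ℚ.- a ∣
    clear = trans (cong (ℚ._* ∣ c ℚ.- d ∣) (sym (ℚ.∣p*q∣≡∣p∣*∣q∣ a b)))
      (trans (sym (ℚ.∣p*q∣≡∣p∣*∣q∣ (a ℚ.* b) (c ℚ.- d))) (cong ∣_∣
        (trans
          (solve 4 (λ a b c d → a :* b :* (c :- d) := c :* a :* b :- d :* b :* a) refl a b c d)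
          (trans (cong₂ (λ s t → s ℚ.* b ℚ.- t ℚ.* a) ca≡1 db≡1)
            (solve 2 (λ a b → con 1ℚ :* b :- con 1ℚ :* a := b :- a) refl a b)))))

  inv-cauchy : Cauchy inv
  inv-cauchy {ε} 0<ε with cauchy x (0<* (0<* 0<γ 0<γ) 0<ε)
  ... | M , p = M , λ {m} {n} i j →
    close (seq x (N ℕ.⊔ m)) (seq x (N ℕ.⊔ n)) (inv m) (inv n)
      (γ≤∣x∣ m) (γ≤∣x∣ n) (inverse m) (inverse n)
      (p (ℕ.≤-trans j (ℕ.m≤n⊔m N n)) (ℕ.≤-trans i (ℕ.m≤n⊔m N m)))

-- The trailing factor 1 copies the unfolding of `_^_`, so that solver goals match definitionally.
:sq :cb : ∀ {n} → Polynomial n → Polynomial n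
:sq x = x :* (x :* con 1ℚ)
:cb x = x :* :sq x

invertible-cubed : x ≈ y ^ 3 → Invertible y → Invertible x
invertible-cubed {x} {y} x≈y³ (t , ty≈1) = t ^ 3 , (begin
  t ^ 3 * x      ≈⟨ *-cong ≈-refl x≈y³ ⟩
  t ^ 3 * y ^ 3  ≈⟨ pointwise (λ n → solve 2 (λ t y → :cb t :* :cb y := :cb (t :* y)) refl
                     (seq t n) (seq y n)) ⟩
  (t * y) ^ 3    ≈⟨ cubed-cong ty≈1 ⟩
  1ℝ ^ 3         ≈⟨ pointwise (λ _ → refl) ⟩
  1ℝ             ∎)

-- This carries invertibility from `r` to `cbrt r`.
invertible-root : x ^ 3 ≈ y → Invertible y → Invertible x
invertible-root {x} {y} x³≈y (t , ty≈1) = t * x ^ 2 , (begin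
  t * x ^ 2 * x  ≈⟨ pointwise (λ n → solve 2 (λ t x → t :* :sq x :* x := t :* :cb x) refl
                     (seq t n) (seq x n)) ⟩
  t * x ^ 3      ≈⟨ *-cong ≈-refl x³≈y ⟩
  t * y          ≈⟨ ty≈1 ⟩
  1ℝ             ∎)

invertible-cancel : Invertible x → x * y ≈ 0ℝ → y ≈ 0ℝ
invertible-cancel {x} {y} (t , tx≈1) xy≈0 = begin
  y            ≈⟨ pointwise (λ n → sym (ℚ.*-identityˡ (seq y n))) ⟩
  1ℝ * y       ≈⟨ *-cong (≈-sym tx≈1) ≈-refl ⟩
  t * x * y    ≈⟨ pointwise (λ n → ℚ.*-assoc (seq t n) (seq x n) (seq y n)) ⟩
  t * (x * y)  ≈⟨ *-cong ≈-refl xy≈0 ⟩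
  t * 0ℝ       ≈⟨ pointwise (λ n → ℚ.*-zeroʳ (seq t n)) ⟩
  0ℝ           ∎

square≈0 : x * x ≈ 0ℝ → x ≈ 0ℝ
square≈0 {x} x²≈0 = sum-of-squares≈0 {y = 0ℝ} (begin
  x * x + 0ℝ * 0ℝ  ≈⟨ pointwise (λ n → ℚ.+-identityʳ _) ⟩
  x * x            ≈⟨ x²≈0 ⟩
  0ℝ               ∎)

-- Congruence of complex arithmetic.

≈ᶜ-refl : u ≈ᶜ u
≈ᶜ-refl = ≈-refl , ≈-refl

+ᶜ-cong : u ≈ᶜ u′ → v ≈ᶜ v′ → u +ᶜ v ≈ᶜ u′ +ᶜ v′
+ᶜ-cong (a , b) (c , d) = +-cong a c , +-cong b d

*ᶜ-cong : u ≈ᶜ u′ → v ≈ᶜ v′ → u *ᶜ v ≈ᶜ u′ *ᶜ v′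
*ᶜ-cong (a , b) (c , d) =
  +-cong (*-cong a c) (neg-cong (*-cong b d)) , +-cong (*-cong a d) (*-cong b c)

-- The coefficients match their parametrised forms only up to `≈`; this moves a zero from one cubic
-- to the other.
cubic-cong : ∀ {p p′ q q′ r r′} w → p ≈ p′ → q ≈ q′ → r ≈ r′ → cubic p q r w ≈ᶜ cubic p′ q′ r′ w
cubic-cong w p≈p′ q≈q′ r≈r′ =
  +ᶜ-cong (+ᶜ-cong (+ᶜ-cong (≈ᶜ-refl {w ^ᶜ 3}) (*ᶜ-cong (p≈p′ , ≈-refl) (≈ᶜ-refl {w ^ᶜ 2})))
                   (*ᶜ-cong (q≈q′ , ≈-refl) (≈ᶜ-refl {w})))
          (r≈r′ , ≈-refl)

-- Zeros of the parametrised cubic.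

re-K im-K re-G im-G : (s x y : ℝ) → ℝ
re-K s x y = x * x * x + - (3ℝ * (x * (y * y))) + - (3ℝ * (s * s * x)) + s * s * s
im-K s x y = 3ℝ * (x * x * y) + - (y * y * y) + - (3ℝ * (s * s * y))
re-G s x y = s * x + - (x * x) + y * y
im-G s x y = s * y + - (x * y + x * y)

:re-K :im-K :re-G :im-G : ∀ {n} → (s x y : Polynomial n) → Polynomial n
:re-K s x y = x :* x :* x :- con 3ℚ :* (x :* (y :* y)) :- con 3ℚ :* (s :* s :* x) :+ s :* s :* s
:im-K s x y = con 3ℚ :* (x :* x :* y) :- y :* y :* y :- con 3ℚ :* (s :* s :* y)
:re-G s x y = s :* x :- x :* x :+ y :* y
:im-G s x y = s :* y :- (x :* y :+ x :* y)

-- The left-hand polynomials below mirror the unfolding of _^ᶜ_ and _*ᶜ_ on the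
-- sequences, zero imaginary parts included, as the solver requires.
re-cubic : ∀ h s x y →
  re (cubic (h * s) (- (h + 3ℝ) * s ^ 2) (s ^ 3) (mkℂ x y)) ≈
    re-K s x y + - (h * s * re-G s x y)
re-cubic h s x y = pointwise λ n →
  solve 4 (λ h s x y →
    let O = con 0ℚ
        x₁ = x :* con 1ℚ :- y :* O
        y₁ = x :* O :+ y :* con 1ℚ
        x₂ = x :* x₁ :- y :* y₁
        y₂ = x :* y₁ :+ y :* x₁
        x₃ = x :* x₂ :- y :* y₂
    in x₃ :+ (h :* s :* x₂ :- O :* y₂) :+ ((:- (h :+ con 3ℚ)) :* :sq s :* x :- O :* y) :+ :cb s
       := :re-K s x y :- h :* s :* :re-G s x y)
    refl (seq h n) (seq s n) (seq x n) (seq y n)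

im-cubic : ∀ h s x y →
  im (cubic (h * s) (- (h + 3ℝ) * s ^ 2) (s ^ 3) (mkℂ x y)) ≈
    im-K s x y + - (h * s * im-G s x y)
im-cubic h s x y = pointwise λ n →
  solve 4 (λ h s x y →
    let O = con 0ℚ
        x₁ = x :* con 1ℚ :- y :* O
        y₁ = x :* O :+ y :* con 1ℚ
        x₂ = x :* x₁ :- y :* y₁
        y₂ = x :* y₁ :+ y :* x₁
        y₃ = x :* y₂ :+ y :* x₂
    in y₃ :+ (h :* s :* y₂ :+ O :* x₂) :+ ((:- (h :+ con 3ℚ)) :* :sq s :* y :+ O :* x) :+ O
       := :im-K s x y :- h :* s :* :im-G s x y)
    refl (seq h n) (seq s n) (seq x n) (seq y n)

-- The right side is `- y` times the imaginary part of K times the conjugate of G. With the factor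
-- `y` kept inside, both summands on the left are squares, so no case split on `y ≈ 0ℝ` is needed.
K∧G-identity : ∀ s x y → let D = x * x + y * y + s * s + - (s * x) in
  s * (y * y) * (s * (y * y)) + y * D * (y * D) ≈
    re-K s x y * (y * im-G s x y) + im-K s x y * - (y * re-G s x y)
K∧G-identity s x y = pointwise λ n →
  solve 3 (λ s x y → let D = x :* x :+ y :* y :+ s :* s :- s :* x in
    s :* (y :* y) :* (s :* (y :* y)) :+ y :* D :* (y :* D)
      := :re-K s x y :* (y :* :im-G s x y) :+ :im-K s x y :* (:- (y :* :re-G s x y)))
    refl (seq s n) (seq x n) (seq y n)

zero-is-real : ∀ h s → Invertible s → ∀ w →
  cubic (h * s) (- (h + 3ℝ) * s ^ 2) (s ^ 3) w ≈ᶜ fromℝ 0ℝ → im w ≈ 0ℝ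
zero-is-real h s s-inv (mkℂ x y) (re≈0 , im≈0) =
  square≈0 (invertible-cancel s-inv (sum-of-squares≈0 {y = y * D} (begin
    s * (y * y) * (s * (y * y)) + y * D * (y * D)
      ≈⟨ K∧G-identity s x y ⟩
    k * (y * g′) + l * - (y * g)
      -- Subtracting a real multiple `c` of G from K does not change the imaginary part of K times
      -- the conjugate of G. With `c = h * s` the new factors are the real and imaginary parts of
      -- the cubic at its zero.
      ≈⟨ pointwise (λ n → solve 6 (λ c k l a b y →
           k :* (y :* b) :+ l :* (:- (y :* a))
             := (k :- c :* a) :* (y :* b) :+ (l :- c :* b) :* (:- (y :* a)))
           refl (seq (h * s) n) (seq k n) (seq l n) (seq g n) (seq g′ n) (seq y n)) ⟩
    (k + - (h * s * g)) * (y * g′) + (l + - (h * s * g′)) * - (y * g)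
      ≈⟨ +-cong (*-cong (≈-trans (≈-sym (re-cubic h s x y)) re≈0) ≈-refl)
                (*-cong (≈-trans (≈-sym (im-cubic h s x y)) im≈0) ≈-refl) ⟩
    0ℝ * (y * g′) + 0ℝ * - (y * g)
      ≈⟨ pointwise (λ n → cong₂ ℚ._+_ (ℚ.*-zeroˡ (seq (y * g′) n)) (ℚ.*-zeroˡ (seq (- (y * g)) n))) ⟩
    0ℝ ∎)))
  where
  k = re-K s x y
  l = im-K s x y
  g = re-G s x y
  g′ = im-G s x y
  D = x * x + y * y + s * s + - (s * x)

-- The coefficient relation in terms of the parameters.

relation⇒parameters : ∀ p q s t → t * s ≈ 1ℝ → p * s + 3ℝ * s ^ 2 + q ≈ 0ℝ →
  q ≈ - (p * t + 3ℝ) * s ^ 2 × p ≈ p * t * s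
relation⇒parameters p q s t ts≈1 relation = q≈ , p≈
  where
  p≈ : p ≈ p * t * s
  p≈ = begin
    p            ≈⟨ pointwise (λ n → sym (ℚ.*-identityʳ (seq p n))) ⟩
    p * 1ℝ       ≈⟨ *-cong ≈-refl (≈-sym ts≈1) ⟩
    p * (t * s)  ≈⟨ pointwise (λ n → sym (ℚ.*-assoc (seq p n) (seq t n) (seq s n))) ⟩
    p * t * s    ∎
  q≈ : q ≈ - (p * t + 3ℝ) * s ^ 2
  q≈ = begin
    q
      ≈⟨ pointwise (λ n → solve 3 (λ p q s →
           q := p :* s :+ con 3ℚ :* :sq s :+ q :- (p :* s :+ con 3ℚ :* :sq s))
           refl (seq p n) (seq q n) (seq s n)) ⟩
    (p * s + 3ℝ * s ^ 2 + q) + - (p * s + 3ℝ * s ^ 2)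
      -- Rewriting `p` as `p * t * s` makes `p * s` equal to `h * s²` with `h = p * t`.
      ≈⟨ +-cong relation (neg-cong (+-cong (*-cong p≈ ≈-refl) ≈-refl)) ⟩
    0ℝ + - (p * t * s * s + 3ℝ * s ^ 2)
      ≈⟨ pointwise (λ n → solve 3 (λ p t s →
           con 0ℚ :- (p :* t :* s :* s :+ con 3ℚ :* :sq s)
             := (:- (p :* t :+ con 3ℚ)) :* :sq s)
           refl (seq p n) (seq t n) (seq s n)) ⟩
    - (p * t + 3ℝ) * s ^ 2 ∎

-- `c` stands for `cbrt r`, which agrees with `s` only up to `≈`. After substitution the terms
-- `h * s²`, `3 * s²` and `- (h + 3) * s²` cancel.
parameters⇒relation : ∀ {p q c h s} → c ≈ s → q ≈ - (h + 3ℝ) * s ^ 2 → p ≈ h * s →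
  p * c + 3ℝ * c ^ 2 + q ≈ 0ℝ
parameters⇒relation {p} {q} {c} {h} {s} c≈s q≈ p≈ = begin
  p * c + 3ℝ * c ^ 2 + q
    ≈⟨ +-cong (+-cong (*-cong p≈ c≈s) (*-cong ≈-refl (squared-cong c≈s))) q≈ ⟩
  h * s * s + 3ℝ * s ^ 2 + - (h + 3ℝ) * s ^ 2
    ≈⟨ pointwise (λ n → solve 2 (λ h s →
         h :* s :* s :+ con 3ℚ :* :sq s :+ (:- (h :+ con 3ℚ)) :* :sq s := con 0ℚ)
         refl (seq h n) (seq s n)) ⟩
  0ℝ ∎

-- The two directions of the equivalence.

Parametrised : (p q r : ℝ) → Set
Parametrised p q r = ∃₂ λ (h s : ℝ) →
  s # 0ℝ × r ≈ s ^ 3 × q ≈ - (h + 3ℝ) * s ^ 2 × p ≈ h * s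

ramanujan⇒parametrised : ∀ {p q r} s → Invertible s → s ^ 3 ≈ r →
  p * s + 3ℝ * s ^ 2 + q ≈ 0ℝ → Parametrised p q r
ramanujan⇒parametrised {p} {q} {r} s s-inv@(t , ts≈1) s³≈r relation =
  p * t , s , invertible⇒#0 {s} s-inv , ≈-sym {s ^ 3} {r} s³≈r ,
  relation⇒parameters p q s t ts≈1 relation

parametrised⇒ramanujan : ∀ {p q r} → Parametrised p q r → IsRamanujanCubic p q r
parametrised⇒ramanujan {p} {q} {r} (h , s , s#0 , r≈ , q≈ , p≈) = record
  { r#0       = invertible⇒#0 (invertible-cubed {r} {s} r≈ s-inv)
  ; realZeros = λ w (re≈0 , im≈0) →
      let re≈ , im≈ = cubic-cong w p≈ q≈ r≈
      in zero-is-real h s s-inv w (≈-trans (≈-sym re≈) re≈0 , ≈-trans (≈-sym im≈) im≈0)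
  ; relation  = parameters⇒relation {p} {q} {cbrt r} {h} {s}
      -- Both `cbrt r` and `s` have cube `r`, hence they agree.
      (cubed-injective {cbrt r} {s} (≈-trans {y = r} (cbrt-cubed r) r≈)) q≈ p≈ }
  where s-inv = #0⇒invertible {s} s#0

theorem3 : ∀ (p q r : ℝ) →
    IsRamanujanCubic p q r ⇔
    (∃₂ λ (h s : ℝ) →
    s # 0ℝ ×
    r ≈ s ^ 3 ×
    q ≈ - (h + 3ℝ) * s ^ 2 ×
    p ≈ h * s)
theorem3 p q r = mk⇔
  (λ rcp → let open IsRamanujanCubic rcp in
    ramanujan⇒parametrised (cbrt r)
      (invertible-root {cbrt r} {r} (cbrt-cubed r) (#0⇒invertible {r} r#0)) (cbrt-cubed r) relation)
  parametrised⇒ramanujan
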